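{- For every positive integer $r$, every ordered graph with delayed rank at least $3r-2$ contains $K_r$ as an interval minor.
   Context: An ordered graph is a finite simple graph with a linear order on its vertices. It contains $K_r$ as an interval minor if its vertex set can be partitioned into $r$ nonempty intervals (sets of consecutive vertices) with an edge between any two of them. It is monotone bipartite if its vertex set splits as $X\cup Y$ with every vertex of $X$ before every vertex of $Y$ and every edge joining $X$ to $Y$ (edgeless graphs included). Canonical delayed decomposition of $(G,<)$, $V=V(G)$: build a rooted tree $T$ top-down, assigning to each node $x$ an interval $L(x)$ of $(V,<)$; the root has $L=V$. For a node $x$: (i) if $|L(x)|=1$, $x$ gets one child, a leaf identified with the vertex of $L(x)$; (ii) if $|L(x)|\ge2$ and $L(x)$ is a module (each vertex outside $L(x)$ is adjacent to all or none of $L(x)$), $x$ gets two children $y_1,y_2$ with $L(y_1)=\{u\}$, $u$ the minimum of $L(x)$, and $L(y_2)=L(x)\setminus\{u\}$; (iii) otherwise, with $u_1\sim u_2$ iff every $w$ in the interval between $u_1,u_2$ has the same neighbourhood in $V\setminus L(x)$ as $u_1$ and $u_2$, the classes of $\sim$ are intervals $I_1<\dots<I_k$ and $x$ gets children $y_1,\dots,y_k$ with $L(y_i)=I_i$. Nodes not in ancestor–descendant relation are ordered by $x<y$ iff $L(x)<L(y)$. For each node $x$, the quotient graph $G_x$ is the ordered graph on the grandchildren of $x$ in which two non-sibling grandchildren $y,y'$ are adjacent iff $G$ has an edge between $L(y)$ and $L(y')$. Labels: nodes without grandparent get label $\emptyset$; otherwise $x$ gets $R$ if some cousin (non-sibling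 node with the same grandparent $p^2(x)$) $x'>x$ has $xx'\in E(G_{p^2(x)})$, else $L$ if some cousin $x'<x$ has $xx'\in E(G_{p^2(x)})$, else $O$. If a node labelled $O$ is not the first child of its parent and its parent has at least $3$ children, its label becomes $O_L$ (resp. $O_R$) if its immediately preceding sibling is labelled $L$ (resp. $R$). The type of a node is the label of its parent. Refined quotient graphs of a non-monotone-bipartite $(G,<)$: for each quotient graph $G_x$ of the canonical decomposition: if $G_x$ is monotone bipartite, it is a refined quotient graph. Otherwise, if the first child of $x$ is labelled $O$, delete its children from $G_x$; remaining vertices have type $R,L,O_R$ or $O_L$; put $R'=\{R,O_R\}$, $L'=\{L,O_L\}$ and classify edges by the classes of the types of their left and right endpoints ($R'R',R'L',L'R',L'L'$). The four refined quotient graphs are: the graph on the remaining vertices with the $R'R'$ edges, minus vertices before the first and after the last vertex of type $R$; with the $R'L'$ edges, minus vertices before the first and after the last vertex of type $L$; with the $L'R'$ edges, minus vertices before the first and after the last vertex of type $R$; with the $L'L'$ edges, minus vertices before the first and after the last vertex of type $L$. Delayed rank: $0$ if $(G,<)$ is monotone bipartite; otherwise $1$ plus the maximum delayed rank of its refined quotient graphs. -}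

module Defs where

open import Data.Nat using (ℕ; zero; suc; _+_; _∸_; _≤_; _<_; _<ᵇ_; _≤ᵇ_; _≡ᵇ_; _<?_)
open import Data.Bool using (Bool; true; false; if_then_else_; _∧_; _∨_; not)
open import Data.Fin using (Fin; toℕ; fromℕ; fromℕ<; inject₁)
  renaming (zero to fzero; suc to fsuc)
open import Data.List using (List; []; _∷_; [_]; _++_; map; concatMap; length;
  lookup; upTo; replicate; reverse; dropWhileᵇ; filterᵇ)
open import Data.Bool.ListAction using (any; all)
open import Data.Product using (Σ; _×_; _,_)
open import Data.Sum using (_⊎_)
open import Data.Maybe using (Maybe; just; nothing)
open import Relation.Nullary using (¬_; yes; no)
open import Relation.Binary.PropositionalEquality using (_≡_; _≢_)

-- Ordered graphs.
-- Vertices are Fin size, ordered by the usual order of Fin.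
-- A simple graph is given by its "upper triangle": for i < j the pair
-- {i,j} is an edge iff adj i j ≡ true (adj i j is ignored unless i < j).

record OrderedGraph : Set where
  constructor ograph
  field
    size : ℕ
    adj  : Fin size → Fin size → Bool

open OrderedGraph public

Edge : (G : OrderedGraph) → Fin (size G) → Fin (size G) → Set
Edge G u v = (toℕ u < toℕ v × adj G u v ≡ true) ⊎ (toℕ v < toℕ u × adj G v u ≡ true)

MonotoneBipartite : OrderedGraph → Set
MonotoneBipartite G =
  Σ ℕ λ s → s ≤ size G ×
    (∀ (i j : Fin (size G)) → Edge G i j → toℕ i < toℕ j →
       toℕ i < s × s ≤ toℕ j)

-- K_r as an interval minor: cut points 0 = b 0 < b 1 < ... < b r = size G;
-- the k-th interval (k : Fin r) is { u | b k ≤ u < b (k+1) }.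
InPart : {n r : ℕ} → (Fin (suc r) → ℕ) → Fin r → Fin n → Set
InPart b k u = b (inject₁ k) ≤ toℕ u × toℕ u < b (fsuc k)

HasKrIntervalMinor : OrderedGraph → ℕ → Set
HasKrIntervalMinor G r =
  Σ (Fin (suc r) → ℕ) λ b →
    b fzero ≡ 0 × b (fromℕ r) ≡ size G ×
    (∀ (k : Fin r) → b (inject₁ k) < b (fsuc k)) ×
    (∀ (k l : Fin r) → k ≢ l →
       Σ (Fin (size G)) λ u → Σ (Fin (size G)) λ v →
         InPart b k u × InPart b l v × Edge G u v)

-- Boolean edge test on natural-number vertices (false out of range)

edgeℕ : OrderedGraph → ℕ → ℕ → Bool
edgeℕ G u v with u <? size G | v <? size G
... | yes p | yes q =
  if u <ᵇ v then adj G (fromℕ< p) (fromℕ< q)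
  else if v <ᵇ u then adj G (fromℕ< q) (fromℕ< p) else false
... | _ | _ = false

record Interval : Set where
  constructor itv
  field
    start : ℕ
    len   : ℕ

open Interval public

elems : Interval → List ℕ
elems I = map (start I +_) (upTo (len I))

inI : Interval → ℕ → Bool
inI I w = (start I ≤ᵇ w) ∧ (w <ᵇ start I + len I)

outside : OrderedGraph → Interval → List ℕ
outside G I = filterᵇ (λ w → not (inI I w)) (upTo (size G))

isModule : OrderedGraph → Interval → Bool
isModule G I = all (λ w → all (λ u → edgeℕ G w u) (elems I)
                        ∨ all (λ u → not (edgeℕ G w u)) (elems I)) (outside G I)

_==ᵇ_ : Bool → Bool → Bool
true  ==ᵇ b = b
false ==ᵇ b = not b

sameOut : OrderedGraph → Interval → ℕ → ℕ → Bool
sameOut G I u v = all (λ w → edgeℕ G w u ==ᵇ edgeℕ G w v) (outside G I)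

-- classes of ~ : maximal runs of consecutive vertices with the same
-- neighbourhood outside I (current class: s .. s+l-1, r vertices remain)
runsFrom : (ℕ → ℕ → Bool) → ℕ → ℕ → ℕ → List Interval
runsFrom same s l zero    = [ itv s l ]
runsFrom same s l (suc r) =
  if same (s + l ∸ 1) (s + l) then runsFrom same s (suc l) r
  else itv s l ∷ runsFrom same (s + l) 1 r

classes : OrderedGraph → Interval → List Interval
classes G (itv a zero)    = []
classes G (itv a (suc m)) = runsFrom (sameOut G (itv a (suc m))) a 1 m

-- The canonical delayed decomposition tree.
-- A node carries its interval L(x) and its ordered list of children;
-- a leaf is a node without children (its interval is the singleton of
-- the vertex it is identified with).

data Tree : Set where
  node : Interval → List Tree → Tree

itvOf : Tree → Interval
itvOf (node I _) = I

children : Tree → List Tree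
children (node _ cs) = cs

-- fuel-driven construction; fuel ≥ len I suffices since children of a
-- non-singleton interval are strictly shorter
build : OrderedGraph → ℕ → Interval → Tree
build G zero    I = node I []
build G (suc f) (itv a zero) = node (itv a zero) []
build G (suc f) (itv a (suc zero)) = node (itv a 1) [ node (itv a 1) [] ]
build G (suc f) (itv a (suc (suc m))) =
  if isModule G (itv a (suc (suc m)))
  then node (itv a (suc (suc m)))
         (build G f (itv a 1) ∷ build G f (itv (suc a) (suc m)) ∷ [])
  else node (itv a (suc (suc m)))
         (map (build G f) (classes G (itv a (suc (suc m)))))

decomposition : OrderedGraph → Tree
decomposition G = build G (suc (size G)) (itv 0 (size G))

data Label : Set where
  l∅ lR lL lO lOL lOR : Label

before : Interval → Interval → Bool
before I J = (start I + len I) ≤ᵇ start J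

edgeBetween : OrderedGraph → Interval → Interval → Bool
edgeBetween G I J = any (λ u → any (λ v → edgeℕ G u v) (elems J)) (elems I)

rawLabel : OrderedGraph → Tree → List Tree → Label
rawLabel G c cs =
  if any (λ c' → before (itvOf c) (itvOf c') ∧ edgeBetween G (itvOf c) (itvOf c')) cs
  then lR
  else if any (λ c' → before (itvOf c') (itvOf c) ∧ edgeBetween G (itvOf c) (itvOf c')) cs
  then lL else lO

-- O → O_L / O_R according to the (original) label of the preceding sibling
adjust : Label → Label → Label
adjust lL lO = lOL
adjust lR lO = lOR
adjust _  l  = l

adjustFrom : Label → List Label → List Label
adjustFrom prev []       = []
adjustFrom prev (l ∷ ls) = adjust prev l ∷ adjustFrom l ls

modifyLabels : List Label → List Label
modifyLabels []       = []
modifyLabels (l ∷ ls) =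
  if 3 ≤ᵇ length (l ∷ ls) then l ∷ adjustFrom l ls else l ∷ ls

-- labels of the children of a node; the argument is `nothing` for the
-- root, and otherwise `just pool` where pool = the grandchildren of the
-- parent of the node that are not children of the node (= the cousins
-- of each child of the node)
childLabels : OrderedGraph → Tree → Maybe (List Tree) → List Label
childLabels G x nothing     = replicate (length (children x)) l∅
childLabels G x (just pool) = modifyLabels (map (λ c → rawLabel G c pool) (children x))

mutual
  nodesFrom : OrderedGraph → Tree → Maybe (List Tree) → List (Tree × List Label)
  nodesFrom G (node I cs) pool =
    (node I cs , childLabels G (node I cs) pool) ∷ nodesList G [] cs

  nodesList : OrderedGraph → List Tree → List Tree → List (Tree × List Label)
  nodesList G bef []          = []
  nodesList G bef (y ∷ after) =
    nodesFrom G y (just (concatMap children bef ++ concatMap children after))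
    ++ nodesList G (bef ++ [ y ]) after

allNodes : OrderedGraph → List (Tree × List Label)
allNodes G = nodesFrom G (decomposition G) nothing

-- a grandchild of x: its interval, the index of its parent among the
-- children of x, and its type (= label of its parent)
record Item : Set where
  constructor item
  field
    iv  : Interval
    grp : ℕ
    typ : Label

open Item public

itemsFrom : ℕ → List Tree → List Label → List Item
itemsFrom k (c ∷ cs) (l ∷ ls) =
  map (λ gc → item (itvOf gc) k l) (children c) ++ itemsFrom (suc k) cs ls
itemsFrom _ _ _ = []

graphOn : List Item → (Item → Item → Bool) → OrderedGraph
graphOn xs f = ograph (length xs) (λ i j → f (lookup xs i) (lookup xs j))

qEdge : OrderedGraph → Item → Item → Bool
qEdge G a b = not (grp a ≡ᵇ grp b) ∧ edgeBetween G (iv a) (iv b)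

quotientGraph : OrderedGraph → Tree × List Label → OrderedGraph
quotientGraph G (x , labs) = graphOn (itemsFrom 0 (children x) labs) (qEdge G)

isR' isL' isTypeR isTypeL : Label → Bool
isR' lR  = true
isR' lOR = true
isR' _   = false
isL' lL  = true
isL' lOL = true
isL' _   = false
isTypeR lR = true
isTypeR _  = false
isTypeL lL = true
isTypeL _  = false

remainingItems : Tree × List Label → List Item
remainingItems (x , lO ∷ labs) =
  filterᵇ (λ a → not (grp a ≡ᵇ 0)) (itemsFrom 0 (children x) (lO ∷ labs))
remainingItems (x , labs) = itemsFrom 0 (children x) labs

trim : (Label → Bool) → List Item → List Item
trim p xs = reverse (dropWhileᵇ (λ a → not (p (typ a)))
                      (reverse (dropWhileᵇ (λ a → not (p (typ a))) xs)))

classEdge : OrderedGraph → (Label → Bool) → (Label → Bool) → Item → Item → Bool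
classEdge G p q a b = qEdge G a b ∧ p (typ a) ∧ q (typ b)

fourRefined : OrderedGraph → Tree × List Label → List OrderedGraph
fourRefined G xl =
  graphOn (trim isTypeR rem) (classEdge G isR' isR') ∷
  graphOn (trim isTypeL rem) (classEdge G isR' isL') ∷
  graphOn (trim isTypeR rem) (classEdge G isL' isR') ∷
  graphOn (trim isTypeL rem) (classEdge G isL' isL') ∷ []
  where rem = remainingItems xl

open import Data.List.Membership.Propositional using (_∈_)

RefinedQuotient : OrderedGraph → OrderedGraph → Set
RefinedQuotient G H =
  Σ (Tree × List Label) λ xl → xl ∈ allNodes G ×
    ((MonotoneBipartite (quotientGraph G xl) × H ≡ quotientGraph G xl)
     ⊎ (¬ MonotoneBipartite (quotientGraph G xl) × H ∈ fourRefined G xl))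

data DelayedRank : OrderedGraph → ℕ → Set where
  rank-mb : ∀ {G} → MonotoneBipartite G → DelayedRank G 0
  rank-suc : ∀ {G d} → ¬ MonotoneBipartite G →
    (∀ H → RefinedQuotient G H → Σ ℕ λ d' → DelayedRank H d' × d' ≤ d) →
    (Σ OrderedGraph λ H → RefinedQuotient G H × DelayedRank H d) →
    DelayedRank G (suc d)

{-# OPTIONS --safe #-}

-- Call a K_r interval minor fat if every part contains an edge.  Delayed rank at
-- least 3r − 2 even yields a fat K_r minor.  Let H be a refined quotient of G at a
-- node x, trimmed to type z ∈ {L, R}.  In each of the four cases the right endpoint
-- of an edge of H has type z or O_z.  A class of type O_z directly follows one of
-- type z, and edges join different classes, so every edge of H spans a vertex of
-- type z.  A vertex of type z is an interval of G all of whose vertices have a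
-- neighbour beyond L(x) on side z.  Hence a fat K_r in H becomes a fat K_r in G
-- together with one further interval, on side z, adjacent to all parts.  If such a
-- further interval is already present in H on side z, it contains the extreme
-- vertex of H, which has type z by trimming, so in G it can be enlarged to contain
-- an edge, giving a fat K_{r+1}.  Along three refinements some side occurs twice,
-- and further intervals survive lifting, so r grows by one.

module Submission where

open import Defs
open import Data.Bool using (Bool; true; false; not; _∧_; _∨_; T; T?)
open import Data.Bool.ListAction using (any; all)
open import Data.Bool.Properties using (∧-conicalˡ; ∧-conicalʳ; T-≡) renaming (_≟_ to _≟ᵇ_)
open import Data.Fin using (Fin; toℕ; fromℕ; fromℕ<; inject₁)
open import Data.Fin.Properties using (any?; toℕ<n; toℕ-fromℕ; toℕ-fromℕ<; fromℕ<-toℕ; toℕ-inject₁; toℕ-injective)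
open import Data.List using (List; []; _∷_; [_]; _++_; map; length; lookup; reverse; dropWhileᵇ; filterᵇ; replicate)
open import Data.List.Properties using (reverse-++; reverse-involutive; unfold-reverse)
open import Data.List.Membership.Propositional using (_∈_)
open import Data.List.Membership.Propositional.Properties using (∈-map⁺; ∈-map⁻; ∈-upTo⁺; ∈-upTo⁻; ∈-filter⁺)
open import Data.List.Relation.Binary.Pointwise using (Pointwise; []; _∷_)
open import Data.List.Relation.Unary.All as All using (All; []; _∷_)
import Data.List.Relation.Unary.All.Properties as All
open import Data.List.Relation.Unary.Any using (here; there)
open import Data.Maybe using (Maybe; just; nothing)
open import Data.Nat using (ℕ; zero; suc; _+_; _*_; _∸_; _≤_; _<_; _<ᵇ_; _≤ᵇ_; _≡ᵇ_; _≤?_; _<?_; z≤n; s≤s; s≤s⁻¹)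
open import Data.Nat.Properties
open import Data.Product using (Σ; ∃; ∃₂; _×_; _,_; proj₁; proj₂)
open import Data.Sum using (_⊎_; inj₁; inj₂)
open import Data.Unit using (⊤; tt)
open import Function using (_∘_; id; Equivalence)
open import Relation.Binary.Definitions using (tri<; tri≈; tri>)
open import Relation.Binary.PropositionalEquality using (_≡_; _≢_; refl; sym; trans; cong; subst)
open import Relation.Nullary using (¬_; yes; no; contradiction)
open import Relation.Nullary.Decidable using (_×-dec_)

-- Fat interval minors

<ᵇ-true : ∀ {m n} → m < n → (m <ᵇ n) ≡ true
<ᵇ-true {m} {n} m<n with m <ᵇ n | <⇒<ᵇ m<n
... | true | _ = refl

<ᵇ-false : ∀ {m n} → n ≤ m → (m <ᵇ n) ≡ false
<ᵇ-false {m} {n} n≤m with m <ᵇ n in eq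
... | false = refl
... | true  = contradiction (<ᵇ⇒< m n (subst T (sym eq) tt)) (≤⇒≯ n≤m)

-- Vertices are natural numbers and the orientation is built in, so that cut points and maps between
-- graphs compose without transporting `Fin` bounds.
E : OrderedGraph → ℕ → ℕ → Set
E G u v = u < v × edgeℕ G u v ≡ true

edgeℕ-bound : ∀ G u v → edgeℕ G u v ≡ true → u < size G × v < size G
edgeℕ-bound G u v e with u <? size G | v <? size G
... | yes p | yes q = p , q

edgeℕ-sym : ∀ G u v → edgeℕ G u v ≡ edgeℕ G v u
edgeℕ-sym G u v with u <? size G | v <? size G
... | no _  | no _  = refl
... | no _  | yes _ = refl
... | yes _ | no _  = refl
... | yes p | yes q with <-cmp u v
... | tri< u<v _ _ rewrite <ᵇ-true u<v | <ᵇ-false (<⇒≤ u<v) = refl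
... | tri≈ _ refl _ rewrite <ᵇ-false (≤-refl {u}) = refl
... | tri> _ _ v<u rewrite <ᵇ-true v<u | <ᵇ-false (<⇒≤ v<u) = refl

E-adj : ∀ G u v → E G u v →
  Σ (u < size G) λ p → Σ (v < size G) λ q → adj G (fromℕ< p) (fromℕ< q) ≡ true
E-adj G u v (u<v , e) with u <? size G | v <? size G
... | yes p | yes q rewrite <ᵇ-true u<v = p , q , e

adj-E : ∀ G i j → toℕ i < toℕ j → adj G i j ≡ true → E G (toℕ i) (toℕ j)
adj-E G i j i<j e = i<j , edge
  where
  edge : edgeℕ G (toℕ i) (toℕ j) ≡ true
  edge with toℕ i <? size G | toℕ j <? size G
  ... | no i≮  | _      = contradiction (toℕ<n i) i≮
  ... | yes _  | no j≮  = contradiction (toℕ<n j) j≮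
  ... | yes p  | yes q
    rewrite <ᵇ-true i<j | fromℕ<-toℕ i p | fromℕ<-toℕ j q = e

¬MB⇒edge : ∀ G → ¬ MonotoneBipartite G → ∃₂ λ u v → E G u v
¬MB⇒edge G ¬mb
  with any? (λ i → any? (λ j → (toℕ i <? toℕ j) ×-dec (adj G i j ≟ᵇ true)))
... | yes (i , j , i<j , e) = toℕ i , toℕ j , adj-E G i j i<j e
-- A graph without edges is monotone bipartite for any split point; 0 is taken.
... | no none = contradiction (0 , z≤n , edgeless) ¬mb
  where
  edgeless : ∀ i j → Edge G i j → toℕ i < toℕ j → toℕ i < 0 × 0 ≤ toℕ j
  edgeless i j (inj₁ (_ , e))   i<j = contradiction (i , j , i<j , e) none
  edgeless i j (inj₂ (j<i , _)) i<j = contradiction j<i (<-asym i<j)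

Part : (ℕ → ℕ) → ℕ → ℕ → Set
Part cut k u = cut k ≤ u × u < cut (suc k)

-- The parts need not cover the graph: vertices before `cut 0` and from `cut r` on stay free for a
-- further interval. Monotonicity of the cuts is not demanded, since `inner` already forces every
-- part to be nonempty.
record FatMinor (G : OrderedGraph) (r : ℕ) (cut : ℕ → ℕ) : Set where
  field
    inner : ∀ k → k < r → ∃₂ λ u v → Part cut k u × Part cut k v × E G u v
    cross : ∀ k l → k < l → l < r →
      ∃₂ λ u v → Part cut k u × Part cut l v × E G u v

open FatMinor

data Side : Set where
  left right : Side

Sees : OrderedGraph → Side → ℕ → ℕ → ℕ → Set
Sees G left  a b u = ∃ λ v → v < a × E G v u
Sees G right a b u = ∃ λ v → b ≤ v × E G u v

Sees-weaken : ∀ {G} z {a a′ b b′ u} → a ≤ a′ → b′ ≤ b →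
  Sees G z a b u → Sees G z a′ b′ u
Sees-weaken left  a≤a′ _ (v , v<a , e) = v , <-≤-trans v<a a≤a′ , e
Sees-weaken right _ b′≤b (v , b≤v , e) = v , ≤-trans b′≤b b≤v , e

-- The further interval on side `z`: all vertices before `cut 0`, or all vertices from `cut r` on,
-- form a set adjacent to each of the `r` parts.
Extends : OrderedGraph → Side → ℕ → (ℕ → ℕ) → Set
Extends G z r cut = ∀ k → k < r → ∃ λ u → Part cut k u × Sees G z (cut 0) (cut r) u

-- With `N` the size of the graph, part `r` absorbs everything from `c r` on. This serves both to
-- stretch the last part of a minor and to append a new last part.
capAfter : ℕ → ℕ → (ℕ → ℕ) → ℕ → ℕ
capAfter r N c k with k ≤? r
... | yes _ = c k
... | no  _ = N

capAfter-≤ : ∀ {r N c k} → k ≤ r → capAfter r N c k ≡ c k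
capAfter-≤ {r} {k = k} k≤r with k ≤? r
... | yes _  = refl
... | no k≰r = contradiction k≤r k≰r

capAfter-> : ∀ {r N c k} → r < k → capAfter r N c k ≡ N
capAfter-> {r} {k = k} r<k with k ≤? r
... | yes k≤r = contradiction r<k (≤⇒≯ k≤r)
... | no _    = refl

capAfter-part : ∀ {r N c k u} → k < r → Part c k u → Part (capAfter r N c) k u
capAfter-part {r} {N} {c} k<r (lo , hi) =
  subst (_≤ _) (sym (capAfter-≤ {r} {N} {c} (<⇒≤ k<r))) lo ,
  subst (_ <_) (sym (capAfter-≤ {r} {N} {c} k<r)) hi

capAfter-last : ∀ r {N} c {u} → c r ≤ u → u < N → Part (capAfter r N c) r u
capAfter-last r {N} c lo hi =
  subst (_≤ _) (sym (capAfter-≤ {r} {N} {c} ≤-refl)) lo ,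
  subst (_ <_) (sym (capAfter-> {r} {N} {c} ≤-refl)) hi

fromZero : (ℕ → ℕ) → ℕ → ℕ
fromZero c zero    = 0
fromZero c (suc k) = c (suc k)

-- Stretching the first part down to 0 and the last one up to `size G` turns the parts into a
-- partition and loses no edge. The cuts increase strictly because each part contains an endpoint of
-- its inner edge.
fatMinor⇒intervalMinor : ∀ G r cut → FatMinor G (suc r) cut → HasKrIntervalMinor G (suc r)
fatMinor⇒intervalMinor G r cut fat =
  bound ∘ toℕ , bound-zero , bound-last , increasing , adjacent
  where
  bound : ℕ → ℕ
  bound = capAfter r (size G) (fromZero cut)

  bound-zero : bound 0 ≡ 0
  bound-zero = capAfter-≤ {r} {size G} {fromZero cut} z≤n

  bound-last : bound (toℕ (fromℕ (suc r))) ≡ size G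
  bound-last rewrite toℕ-fromℕ r = capAfter-> {r} {size G} {fromZero cut} ≤-refl

  fromZero-≤ : ∀ k → fromZero cut k ≤ cut k
  fromZero-≤ zero    = z≤n
  fromZero-≤ (suc k) = ≤-refl

  widen : ∀ {k u} → k ≤ r → u < size G → Part cut k u → Part bound k u
  widen {k} k≤r u<n (lo , hi) with <-cmp k r
  ... | tri< k<r _ _ = capAfter-part k<r (≤-trans (fromZero-≤ k) lo , hi)
  ... | tri≈ _ refl _ = capAfter-last k (fromZero cut) (≤-trans (fromZero-≤ k) lo) u<n
  ... | tri> _ _ k>r = contradiction k>r (≤⇒≯ k≤r)

  finPart : ∀ (k : Fin (suc r)) {u} (u<n : u < size G) → Part cut (toℕ k) u →
    InPart (bound ∘ toℕ) k (fromℕ< u<n)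
  finPart k u<n p rewrite toℕ-inject₁ k | toℕ-fromℕ< u<n = widen (s≤s⁻¹ (toℕ<n k)) u<n p

  increasing : ∀ (k : Fin (suc r)) → bound (toℕ (inject₁ k)) < bound (suc (toℕ k))
  increasing k rewrite toℕ-inject₁ k with inner fat (toℕ k) (toℕ<n k)
  ... | u , v , pu , pv , e with widen (s≤s⁻¹ (toℕ<n k)) (proj₁ (edgeℕ-bound G u v (proj₂ e))) pu
  ... | lo , hi = ≤-<-trans lo hi

  forward : ∀ (k l : Fin (suc r)) → toℕ k < toℕ l →
    Σ (Fin (size G)) λ u → Σ (Fin (size G)) λ v →
      InPart (bound ∘ toℕ) k u × InPart (bound ∘ toℕ) l v × (toℕ u < toℕ v × adj G u v ≡ true)
  forward k l k<l with cross fat (toℕ k) (toℕ l) k<l (toℕ<n l)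
  ... | u , v , pu , pv , e@(u<v , _) with E-adj G u v e
  ... | p , q , a = fromℕ< p , fromℕ< q , finPart k p pu , finPart l q pv , lt , a
    where
    lt : toℕ (fromℕ< p) < toℕ (fromℕ< q)
    lt rewrite toℕ-fromℕ< p | toℕ-fromℕ< q = u<v

  adjacent : ∀ (k l : Fin (suc r)) → k ≢ l →
    Σ (Fin (size G)) λ u → Σ (Fin (size G)) λ v →
      InPart (bound ∘ toℕ) k u × InPart (bound ∘ toℕ) l v × Edge G u v
  adjacent k l k≢l with <-cmp (toℕ k) (toℕ l)
  ... | tri< k<l _ _ with forward k l k<l
  ...   | u , v , pu , pv , e = u , v , pu , pv , inj₁ e
  adjacent k l k≢l | tri≈ _ k≡l _ = contradiction (toℕ-injective k≡l) k≢l
  adjacent k l k≢l | tri> _ _ l<k with forward l k l<k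
  ...   | v , u , pv , pu , e = u , v , pu , pv , inj₂ e

-- What a refined quotient H of G trimmed to type z provides: vertex i of H is
-- the interval [lift i , lift (i + 1)) of G up to gaps, [lo , hi) is L(x), and a
-- marked vertex is one of type z.
record Refines (z : Side) (H G : OrderedGraph) : Set where
  field
    lift  : ℕ → ℕ
    lo hi : ℕ
    mono  : ∀ {i j} → i ≤ j → lift i ≤ lift j
    lo≤   : ∀ i → lo ≤ lift i
    ≤hi   : ∀ i → lift i ≤ hi
    edge  : ∀ {u v} → E H u v →
      ∃₂ λ u′ v′ → Part lift u u′ × Part lift v v′ × E G u′ v′
  Marked : ℕ → Set
  Marked t = ∃ λ u → Part lift t u × Sees G z lo hi u
  field
    marked-between : ∀ {u v} → E H u v → ∃ λ t → u ≤ t × t ≤ v × Marked t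
    marked-first   : 0 < size H → Marked 0
    marked-last    : ∀ {t} → suc t ≡ size H → Marked t

-- Lifting fat minors and further intervals along a refinement

module _ {z H G} (R : Refines z H G) where
  open Refines R

  lift-part : ∀ cut {k u u′} → Part cut k u → Part lift u u′ → Part (lift ∘ cut) k u′
  lift-part cut (c≤u , u<c) (l≤u′ , u′<l) =
    ≤-trans (mono c≤u) l≤u′ , <-≤-trans u′<l (mono u<c)

  liftFat : ∀ {r cut} → FatMinor H r cut → FatMinor G r (lift ∘ cut)
  liftFat {cut = cut} fat .inner k k<r with inner fat k k<r
  ... | u , v , pu , pv , e with edge e
  ... | u′ , v′ , qu , qv , e′ = u′ , v′ , lift-part cut pu qu , lift-part cut pv qv , e′
  liftFat {cut = cut} fat .cross k l k<l l<r with cross fat k l k<l l<r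
  ... | u , v , pu , pv , e with edge e
  ... | u′ , v′ , qu , qv , e′ = u′ , v′ , lift-part cut pu qu , lift-part cut pv qv , e′

  -- The side `y` need not be the side `z` of the trimming: monotonicity of `lift` alone keeps the
  -- far endpoint of an edge beyond the lifted cut.
  liftExtends : ∀ {y r cut} → Extends H y r cut → Extends G y r (lift ∘ cut)
  liftExtends {left} {cut = cut} ext k k<r with ext k k<r
  ... | u , pu , v , v<c , e with edge e
  ... | v′ , u′ , (_ , v′<) , qu , e′ =
    u′ , lift-part cut pu qu , v′ , <-≤-trans v′< (mono v<c) , e′
  liftExtends {right} {cut = cut} ext k k<r with ext k k<r
  ... | u , pu , v , c≤v , e with edge e
  ... | u′ , v′ , qu , (≤v′ , _) , e′ =
    u′ , lift-part cut pu qu , v′ , ≤-trans (mono c≤v) ≤v′ , e′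

  -- The inner edge of a part spans a marked vertex, which belongs to the same part since parts are
  -- intervals. That vertex has a neighbour in `G` beyond `[lo , hi)`, and all lifted cuts lie
  -- between `lo` and `hi`.
  fat⇒extends : ∀ {r cut} → FatMinor H r cut → Extends G z r (lift ∘ cut)
  fat⇒extends {r} {cut} fat k k<r with inner fat k k<r
  ... | u , v , (c≤u , _) , (_ , v<c) , e with marked-between e
  ... | t , u≤t , t≤v , w , pw , sees =
    w , lift-part cut (≤-trans c≤u u≤t , ≤-<-trans t≤v v<c) pw ,
    Sees-weaken z (lo≤ (cut 0)) (≤hi (cut r)) sees

-- The further interval becomes a part of its own, with `Extends` supplying the cross edges. Its
-- inner edge comes from the extreme vertex of `H` on side `z`: it is marked, so its lift contains a
-- vertex with a neighbour still further out on that side.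
fatten : ∀ {z H G r cut} → Refines z H G → FatMinor H (suc r) cut →
  Extends H z (suc r) cut → ∃ λ cut′ → FatMinor G (suc (suc r)) cut′
fatten {left} {H} {G} {r} {cut} R fat ext = cut′ , fat′
  where
  open Refines R

  cut′ : ℕ → ℕ
  cut′ zero    = 0
  cut′ (suc k) = lift (cut k)

  fatG = liftFat R fat
  extG = liftExtends R {left} ext

  -- Part 0 has a neighbour in `H` before `cut 0`, so vertex 0 of `H` exists and lies in the further
  -- interval. This is where at least one part is needed.
  0<c : 0 < cut 0 × 0 < size H
  0<c with ext 0 (s≤s z≤n)
  ... | u , _ , v , v<c , _ , e =
    ≤-<-trans z≤n v<c , ≤-<-trans z≤n (proj₁ (edgeℕ-bound H v u e))

  fat′ : FatMinor G (suc (suc r)) cut′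
  fat′ .inner zero _ with marked-first (proj₂ 0<c)
  ... | u , (_ , u<) , v , v<lo , e =
    v , u , (z≤n , <-≤-trans v<lo (lo≤ _)) , (z≤n , <-≤-trans u< (mono (proj₁ 0<c))) , e
  fat′ .inner (suc k) k<r = inner fatG k (s≤s⁻¹ k<r)
  fat′ .cross zero (suc l) _ l<r with extG l (s≤s⁻¹ l<r)
  ... | u , pu , v , v< , e = v , u , (z≤n , v<) , pu , e
  fat′ .cross (suc k) (suc l) k<l l<r = cross fatG k l (s≤s⁻¹ k<l) (s≤s⁻¹ l<r)
fatten {right} {H} {G} {r} {cut} R fat ext = cut′ , fat′
  where
  open Refines R

  cut′ : ℕ → ℕ
  cut′ = capAfter (suc r) (size G) (lift ∘ cut)

  fatG = liftFat R fat
  extG = liftExtends R {right} ext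

  -- Mirror image: some neighbour `v` lies at or after the last cut, hence so does the last vertex,
  -- which is `v + o` with `suc v + o` equal to `size H`.
  lastVertex : ∃ λ t → cut (suc r) ≤ t × suc t ≡ size H
  lastVertex with ext 0 (s≤s z≤n)
  ... | u , _ , v , c≤v , _ , e with m≤n⇒∃[o]m+o≡n (proj₂ (edgeℕ-bound H u v e))
  ... | o , eq = v + o , ≤-trans c≤v (m≤m+n v o) , eq

  below : ∀ {u v} → E G u v → v < size G
  below {u} {v} (_ , e) = proj₂ (edgeℕ-bound G u v e)

  fat′ : FatMinor G (suc (suc r)) cut′
  fat′ .inner k k<r with <-cmp k (suc r)
  ... | tri< k< _ _ with inner fatG k k<
  ...   | u , v , pu , pv , e = u , v , capAfter-part k< pu , capAfter-part k< pv , e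
  fat′ .inner k k<r | tri> _ _ k> = contradiction k> (≤⇒≯ (s≤s⁻¹ k<r))
  fat′ .inner k k<r | tri≈ _ refl _ with lastVertex
  ... | t , c≤t , eq with marked-last eq
  ... | u , (≤u , _) , v , hi≤v , e =
    u , v , capAfter-last (suc r) (lift ∘ cut) c≤u (<-trans (proj₁ e) (below e)) ,
    capAfter-last (suc r) (lift ∘ cut) (≤-trans c≤u (<⇒≤ (proj₁ e))) (below e) , e
    where
    c≤u : lift (cut (suc r)) ≤ u
    c≤u = ≤-trans (mono c≤t) ≤u
  fat′ .cross k l k<l l<r with <-cmp l (suc r)
  ... | tri< l< _ _ with cross fatG k l k<l l<
  ...   | u , v , pu , pv , e =
    u , v , capAfter-part (<-trans k<l l<) pu , capAfter-part l< pv , e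
  fat′ .cross k l k<l l<r | tri> _ _ l> = contradiction l> (≤⇒≯ (s≤s⁻¹ l<r))
  fat′ .cross k l k<l l<r | tri≈ _ refl _ with extG k k<l
  ... | u , pu , v , c≤v , e = u , v , capAfter-part k<l pu , capAfter-last (suc r) (lift ∘ cut) c≤v (below e) , e

-- A further interval is created by the inner of two refinements with equal sides and made fat by
-- the outer one. If `z₁` and `z₃` are the equal pair, it is lifted through `R₂` in between; if `z₂`
-- and `z₃` are, the enlarged minor is lifted through `R₁`.
threeSteps : ∀ {H₃ H₂ H₁ G r cut} z₁ z₂ z₃ →
  Refines z₃ H₃ H₂ → Refines z₂ H₂ H₁ → Refines z₁ H₁ G →
  FatMinor H₃ (suc r) cut → ∃ λ cut′ → FatMinor G (suc (suc r)) cut′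
threeSteps left  left  _ R₃ R₂ R₁ fat =
  fatten R₁ (liftFat R₂ (liftFat R₃ fat)) (fat⇒extends R₂ (liftFat R₃ fat))
threeSteps right right _ R₃ R₂ R₁ fat =
  fatten R₁ (liftFat R₂ (liftFat R₃ fat)) (fat⇒extends R₂ (liftFat R₃ fat))
threeSteps left  right left  R₃ R₂ R₁ fat =
  fatten R₁ (liftFat R₂ (liftFat R₃ fat)) (liftExtends R₂ {left} (fat⇒extends R₃ fat))
threeSteps right left  right R₃ R₂ R₁ fat =
  fatten R₁ (liftFat R₂ (liftFat R₃ fat)) (liftExtends R₂ {right} (fat⇒extends R₃ fat))
threeSteps left  right right R₃ R₂ R₁ fat
  with fatten R₂ (liftFat R₃ fat) (fat⇒extends R₃ fat)
... | _ , fat′ = _ , liftFat R₁ fat′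
threeSteps right left  left  R₃ R₂ R₁ fat
  with fatten R₂ (liftFat R₃ fat) (fat⇒extends R₃ fat)
... | _ , fat′ = _ , liftFat R₁ fat′

-- The decomposition tree

any-true : ∀ {A : Set} (p : A → Bool) xs → any p xs ≡ true → ∃ λ x → x ∈ xs × p x ≡ true
any-true p (x ∷ xs) h with p x in eq
... | true = x , here refl , eq
... | false with any-true p xs h
...   | y , y∈xs , py = y , there y∈xs , py

all-true : ∀ {A : Set} (p : A → Bool) {xs x} → all p xs ≡ true → x ∈ xs → p x ≡ true
all-true p {x ∷ xs} h (here refl) = ∧-conicalˡ (p x) _ h
all-true p {x ∷ xs} h (there y∈)  = all-true p (∧-conicalʳ (p x) _ h) y∈

stop : Interval → ℕ
stop I = start I + len I

Inside Outside : Interval → ℕ → Set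
Inside  I u = start I ≤ u × u < stop I
Outside I w = w < start I ⊎ stop I ≤ w

∈-elems⁻ : ∀ I {u} → u ∈ elems I → Inside I u
∈-elems⁻ I u∈ with ∈-map⁻ (start I +_) u∈
... | i , i∈ , refl = m≤m+n (start I) i , +-monoʳ-< (start I) (∈-upTo⁻ i∈)

∈-elems⁺ : ∀ I {u} → Inside I u → u ∈ elems I
∈-elems⁺ I {u} (s≤u , u<) with m≤n⇒∃[o]m+o≡n s≤u
... | i , refl = ∈-map⁺ (start I +_) (∈-upTo⁺ (+-cancelˡ-< (start I) i (len I) u<))

inI-false : ∀ I {w} → Outside I w → inI I w ≡ false
inI-false I {w} (inj₁ w<s) with start I ≤ᵇ w in eq
... | false = refl
... | true  = contradiction (≤ᵇ⇒≤ (start I) w (subst T (sym eq) tt)) (<⇒≱ w<s)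
inI-false I {w} (inj₂ e≤w) rewrite <ᵇ-false e≤w with start I ≤ᵇ w
... | false = refl
... | true  = refl

∈-outside⁺ : ∀ G I {w} → w < size G → Outside I w → w ∈ outside G I
∈-outside⁺ G I {w} w<n out =
  ∈-filter⁺ (T? ∘ λ v → not (inI I v)) (∈-upTo⁺ w<n) (subst (T ∘ not) (sym (inI-false I out)) tt)

edgeBetween⁻ : ∀ G I J → edgeBetween G I J ≡ true →
  ∃₂ λ u v → Inside I u × Inside J v × edgeℕ G u v ≡ true
edgeBetween⁻ G I J h with any-true _ (elems I) h
... | u , u∈ , h′ with any-true _ (elems J) h′
... | v , v∈ , e = u , v , ∈-elems⁻ I u∈ , ∈-elems⁻ J v∈ , e

-- Here `w` ranges over all numbers outside `I`. Those beyond the graph have no edges, so this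
-- agrees with the finite tests in `sameOut` and `isModule`.
Alike : OrderedGraph → Interval → ℕ → ℕ → Set
Alike G I u v = ∀ w → Outside I w → edgeℕ G w u ≡ edgeℕ G w v

edgeℕ-out : ∀ G {w} u → size G ≤ w → edgeℕ G w u ≡ false
edgeℕ-out G {w} u n≤w with edgeℕ G w u in eq
... | false = refl
... | true  = contradiction (proj₁ (edgeℕ-bound G w u eq)) (≤⇒≯ n≤w)

==ᵇ⇒≡ : ∀ {b c} → (b ==ᵇ c) ≡ true → b ≡ c
==ᵇ⇒≡ {true}  {true}  _ = refl
==ᵇ⇒≡ {false} {false} _ = refl

sameOut⇒alike : ∀ G I u v → sameOut G I u v ≡ true → Alike G I u v
sameOut⇒alike G I u v h w out with <-≤-connex w (size G)
... | inj₁ w<n = ==ᵇ⇒≡ (all-true _ h (∈-outside⁺ G I w<n out))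
... | inj₂ n≤w  = trans (edgeℕ-out G u n≤w) (sym (edgeℕ-out G v n≤w))

not-true : ∀ {b} → not b ≡ true → b ≡ false
not-true {false} _ = refl

∨-true : ∀ {b c} → b ∨ c ≡ true → b ≡ true ⊎ c ≡ true
∨-true {true}  _ = inj₁ refl
∨-true {false} h = inj₂ h

module⇒alike : ∀ G I → isModule G I ≡ true → ∀ u v → Inside I u → Inside I v → Alike G I u v
module⇒alike G I h u v u∈ v∈ w out with <-≤-connex w (size G)
... | inj₂ n≤w = trans (edgeℕ-out G u n≤w) (sym (edgeℕ-out G v n≤w))
... | inj₁ w<n with ∨-true (all-true _ h (∈-outside⁺ G I w<n out))
...   | inj₁ all∈ = trans (all-true _ all∈ (∈-elems⁺ I u∈)) (sym (all-true _ all∈ (∈-elems⁺ I v∈)))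
...   | inj₂ all∉ = trans (not-true (all-true _ all∉ (∈-elems⁺ I u∈)))
                          (sym (not-true (all-true _ all∉ (∈-elems⁺ I v∈))))

-- Gaps are allowed between the intervals and at both ends, so that every contiguous sublist is
-- sorted within the same bounds.
Sorted : {X : Set} → (X → Interval) → ℕ → ℕ → List X → Set
Sorted f a b []       = a ≤ b
Sorted f a b (x ∷ xs) = a ≤ start (f x) × 1 ≤ len (f x) × Sorted f (stop (f x)) b xs

module _ {X : Set} (f : X → Interval) where

  sorted-≤ : ∀ {a b} xs → Sorted f a b xs → a ≤ b
  sorted-≤ []       a≤b = a≤b
  sorted-≤ (x ∷ xs) (a≤s , _ , s) = ≤-trans a≤s (≤-trans (m≤m+n _ _) (sorted-≤ xs s))

  sorted-weakenˡ : ∀ {a a′ b} xs → a′ ≤ a → Sorted f a b xs → Sorted f a′ b xs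
  sorted-weakenˡ []       a′≤a a≤b = ≤-trans a′≤a a≤b
  sorted-weakenˡ (x ∷ xs) a′≤a (a≤s , s) = ≤-trans a′≤a a≤s , s

  sorted-++⁺ : ∀ {a m b} xs {ys} → Sorted f a m xs → Sorted f m b ys → Sorted f a b (xs ++ ys)
  sorted-++⁺ []       {ys} a≤m s = sorted-weakenˡ ys a≤m s
  sorted-++⁺ (x ∷ xs) (a≤s , 1≤l , s) s′ = a≤s , 1≤l , sorted-++⁺ xs s s′

  sorted-++⁻ˡ : ∀ {a b} xs {ys} → Sorted f a b (xs ++ ys) → Sorted f a b xs
  sorted-++⁻ˡ []       {ys} s = sorted-≤ ys s
  sorted-++⁻ˡ (x ∷ xs) (a≤s , 1≤l , s) = a≤s , 1≤l , sorted-++⁻ˡ xs s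

  sorted-++⁻ʳ : ∀ {a b} xs {ys} → Sorted f a b (xs ++ ys) → Sorted f a b ys
  sorted-++⁻ʳ []       s = s
  sorted-++⁻ʳ (x ∷ xs) {ys} (a≤s , _ , s) =
    sorted-weakenˡ ys (≤-trans a≤s (m≤m+n _ _)) (sorted-++⁻ʳ xs s)

  sorted⇒all : ∀ {a b} xs → Sorted f a b xs →
    All (λ x → a ≤ start (f x) × 1 ≤ len (f x) × stop (f x) ≤ b) xs
  sorted⇒all []       _ = []
  sorted⇒all (x ∷ xs) (a≤s , 1≤l , s) =
    (a≤s , 1≤l , sorted-≤ xs s) ∷
    All.map (λ (s≤ , rest) → ≤-trans (≤-trans a≤s (m≤m+n _ _)) s≤ , rest) (sorted⇒all xs s)

  sorted-map : ∀ {Y : Set} {g : Y → Interval} (h : X → Y) → (∀ x → g (h x) ≡ f x) →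
    ∀ {a b} xs → Sorted f a b xs → Sorted g a b (map h xs)
  sorted-map h eq []       s = s
  sorted-map h eq (x ∷ xs) (a≤s , 1≤l , s) rewrite eq x =
    a≤s , 1≤l , sorted-map h eq xs s

runs-sorted : ∀ same s l r {b} → 1 ≤ l → s + l + r ≡ b → Sorted id s b (runsFrom same s l r)
runs-sorted same s l zero    1≤l refl = ≤-refl , 1≤l , m≤m+n (s + l) 0
runs-sorted same s l (suc r) 1≤l eq with same (s + l ∸ 1) (s + l)
... | true  = runs-sorted same s (suc l) r (s≤s z≤n)
                (trans (cong (_+ r) (+-suc s l)) (trans (sym (+-suc (s + l) r)) eq))
... | false = ≤-refl , 1≤l , runs-sorted same (s + l) 1 r ≤-refl (trans (+-assoc (s + l) 1 r) eq)

Homogeneous : OrderedGraph → Interval → Interval → Set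
Homogeneous G I J = ∀ u v → Inside J u → Inside J v → Alike G I u v

singleton-≡ : ∀ {a u v} → Inside (itv a 1) u → Inside (itv a 1) v → u ≡ v
singleton-≡ {a} p q = trans (at-a p) (sym (at-a q))
  where
  at-a : ∀ {u} → Inside (itv a 1) u → u ≡ a
  at-a {u} (a≤u , u<) = ≤-antisym (s≤s⁻¹ (subst (u <_) (+-comm a 1) u<)) a≤u

singleton-homogeneous : ∀ G I a → Homogeneous G I (itv a 1)
singleton-homogeneous G I a u v u∈ v∈ with singleton-≡ {a} {u} {v} u∈ v∈
... | refl = λ _ _ → refl

-- The run in progress is kept homogeneous. A new vertex is compared only with the last vertex of
-- the run; transitivity extends the agreement to the whole run.
runs-homogeneous : ∀ G I s l r → 1 ≤ l → Homogeneous G I (itv s l) →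
  All (Homogeneous G I) (runsFrom (sameOut G I) s l r)
runs-homogeneous G I s l zero    1≤l hom = hom ∷ []
runs-homogeneous G I s l (suc r) 1≤l hom with sameOut G I (s + l ∸ 1) (s + l) in eq
... | false = hom ∷ runs-homogeneous G I (s + l) 1 r ≤-refl (singleton-homogeneous G I (s + l))
... | true  = runs-homogeneous G I s (suc l) r (s≤s z≤n) hom′
  where
  prev : ℕ
  prev = s + l ∸ 1

  prev∈ : Inside (itv s l) prev
  prev∈ = ∸-monoˡ-≤ 1 (subst (_≤ s + l) (+-comm s 1) (+-monoʳ-≤ s 1≤l)) ,
    ≤-reflexive (m+[n∸m]≡n (≤-trans 1≤l (m≤n+m l s)))

  toPrev : ∀ {u} → Inside (itv s (suc l)) u → Alike G I u prev
  toPrev {u} (s≤u , u<) with m≤n⇒m<n∨m≡n (s≤s⁻¹ (subst (u <_) (+-suc s l) u<))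
  ... | inj₁ u<′ = hom u prev (s≤u , u<′) prev∈
  ... | inj₂ refl = λ w out → sym (sameOut⇒alike G I prev (s + l) eq w out)

  hom′ : Homogeneous G I (itv s (suc l))
  hom′ u v u∈ v∈ w out = trans (toPrev u∈ w out) (sym (toPrev v∈ w out))

-- Children are cut off all together when the fuel runs out, never for some siblings only.
Uniform : List Tree → Set
Uniform cs = ∀ {c c′} → c ∈ cs → c′ ∈ cs → children c ≢ [] → children c′ ≢ []

data Valid (G : OrderedGraph) : Tree → Set where
  valid : ∀ {I cs} → Sorted itvOf (start I) (stop I) cs →
    All (Homogeneous G I ∘ itvOf) cs → Uniform cs → All (Valid G) cs →
    Valid G (node I cs)

itvOf-build : ∀ G f I → itvOf (build G f I) ≡ I
itvOf-build G zero    I = refl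
itvOf-build G (suc f) (itv a zero) = refl
itvOf-build G (suc f) (itv a (suc zero)) = refl
itvOf-build G (suc f) (itv a (suc (suc m))) with isModule G (itv a (suc (suc m)))
... | true  = refl
... | false = refl

runs-nonempty : ∀ same s l r → runsFrom same s l r ≢ []
runs-nonempty same s l (suc r) eq with same (s + l ∸ 1) (s + l)
... | true = runs-nonempty same s (suc l) r eq

map-nonempty : ∀ {A B : Set} (f : A → B) xs → xs ≢ [] → map f xs ≢ []
map-nonempty f []       ne _ = ne refl

build-nonempty : ∀ G f I → 1 ≤ len I → children (build G (suc f) I) ≢ []
build-nonempty G f (itv a (suc (suc m))) _ eq with isModule G (itv a (suc (suc m)))
... | false = map-nonempty (build G f) _ (runs-nonempty _ a 1 (suc m)) eq

node-valid : ∀ G f I is → Sorted id (start I) (stop I) is → All (Homogeneous G I) is →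
  (∀ J → Valid G (build G f J)) → Valid G (node I (map (build G f) is))
node-valid G f I is sorted hom sub =
  valid (sorted-map id (build G f) (itvOf-build G f) is sorted)
        (All.map⁺ (All.map (λ {J} → subst (Homogeneous G I) (sym (itvOf-build G f J))) hom))
        (uniform f)
        (All.map⁺ (All.universal sub is))
  where
  -- All siblings are built with the same fuel: with none left no sibling has children, otherwise
  -- each has, because its interval is nonempty.
  uniform : ∀ f → Uniform (map (build G f) is)
  uniform zero c∈ _ ne with ∈-map⁻ (build G zero) c∈
  ... | _ , _ , refl = contradiction refl ne
  uniform (suc f) _ c′∈ _ with ∈-map⁻ (build G (suc f)) c′∈
  ... | J , J∈ , refl = build-nonempty G f J (proj₁ (proj₂ (All.lookup (sorted⇒all id is sorted) J∈)))

leaf-valid : ∀ G I → Valid G (node I [])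
leaf-valid G I = valid (m≤m+n (start I) (len I)) [] (λ ()) []

build-valid : ∀ G f I → Valid G (build G f I)
build-valid G zero    I = leaf-valid G I
build-valid G (suc f) (itv a zero) = leaf-valid G (itv a zero)
build-valid G (suc f) (itv a (suc zero)) =
  valid (≤-refl , ≤-refl , ≤-refl)
        (singleton-homogeneous G (itv a 1) a ∷ [])
        (λ { (here refl) _ ne → contradiction refl ne })
        (leaf-valid G (itv a 1) ∷ [])
build-valid G (suc f) (itv a (suc (suc m))) with isModule G (itv a (suc (suc m))) in eq
-- In a module all vertices of `I` already agree outside `I`, so any two subintervals are
-- homogeneous.
... | true =
  node-valid G f (itv a (suc (suc m))) (itv a 1 ∷ itv (suc a) (suc m) ∷ [])
    (≤-refl , ≤-refl , ≤-reflexive (+-comm a 1) , s≤s z≤n , ≤-reflexive (sym (+-suc a (suc m))))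
    ((λ u v u∈ v∈ → hom u v (widen₁ {u} u∈) (widen₁ {v} v∈)) ∷
     (λ u v u∈ v∈ → hom u v (widen₂ {u} u∈) (widen₂ {v} v∈)) ∷ [])
    (build-valid G f)
  where
  I = itv a (suc (suc m))
  hom : Homogeneous G I I
  hom = module⇒alike G I eq
  widen₁ : ∀ {u} → Inside (itv a 1) u → Inside I u
  widen₁ (a≤u , u<) = a≤u , <-≤-trans u< (+-monoʳ-≤ a (s≤s z≤n))
  widen₂ : ∀ {u} → Inside (itv (suc a) (suc m)) u → Inside I u
  widen₂ {u} (a<u , u<) = <⇒≤ a<u , subst (u <_) (sym (+-suc a (suc m))) u<
... | false =
  node-valid G f (itv a (suc (suc m))) (classes G (itv a (suc (suc m))))
    (runs-sorted _ a 1 (suc m) ≤-refl (+-assoc a 1 (suc m)))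
    (runs-homogeneous G _ a 1 (suc m) ≤-refl (singleton-homogeneous G _ a))
    (build-valid G f)

-- Cousins lie outside the interval of the node

Apart : Interval → Interval → Set
Apart I J = stop J ≤ start I ⊎ stop I ≤ start J

PoolApart : Interval → Maybe (List Tree) → Set
PoolApart I nothing     = ⊤
PoolApart I (just pool) = All (Apart I ∘ itvOf) pool

-- The labels must be tied to a pool of cousins disjoint from L(x): only then does a label R or L of
-- a child of `x` record an edge that leaves L(x).
Sound : OrderedGraph → Tree × List Label → Set
Sound G (x , labs) =
  Valid G x × ∃ λ pool → labs ≡ childLabels G x pool × PoolApart (itvOf x) pool

children-all : ∀ {G} {P : Tree → Set} t → Valid G t →
  (∀ {c} → start (itvOf t) ≤ start (itvOf c) → stop (itvOf c) ≤ stop (itvOf t) → P c) →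
  All P (children t)
children-all (node I cs) (valid sorted _ _ _) f =
  All.map (λ (s≤ , _ , ≤e) → f s≤ ≤e) (sorted⇒all itvOf cs sorted)

nodesFrom-sound : ∀ G x pool → Valid G x → PoolApart (itvOf x) pool →
  All (Sound G) (nodesFrom G x pool)
-- The pool for `y` consists of the children of its siblings, which stay inside these siblings and
-- hence away from L(y). For the earlier siblings only their children matter, so the invariant
-- bounds just those.
nodesList-sound : ∀ G bef cs {a b} → All (λ t → All (λ c → stop (itvOf c) ≤ a) (children t)) bef →
  Sorted itvOf a b cs → All (Valid G) cs → All (Sound G) (nodesList G bef cs)

nodesFrom-sound G (node I cs) pool v@(valid sorted _ _ vs) apart =
  (v , pool , refl , apart) ∷ nodesList-sound G [] cs [] sorted vs

nodesList-sound G bef []           _  _ _ = []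
nodesList-sound G bef (y ∷ after) {a} {b} before′ (a≤s , _ , sorted) (v ∷ vs) =
  All.++⁺
    (nodesFrom-sound G y _ v
      (All.++⁺ (All.concat⁺ (All.map⁺ (All.map (All.map (λ e≤ → inj₁ (≤-trans e≤ a≤s))) before′)))
               (All.concat⁺ (All.map⁺ (after-apart after sorted vs)))))
    (nodesList-sound G (bef ++ [ y ]) after
      (All.++⁺ (All.map (All.map (λ e≤ → ≤-trans e≤ (≤-trans a≤s (m≤m+n _ _)))) before′)
               (children-all y v (λ _ ≤e → ≤e) ∷ []))
      sorted vs)
  where
  after-apart : ∀ {a′ b} ts → Sorted itvOf a′ b ts → All (Valid G) ts →
    All (λ t → All (λ c → stop (itvOf c) ≤ start (itvOf y) ⊎ a′ ≤ start (itvOf c)) (children t)) ts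
  after-apart ts sorted vs =
    All.map (λ {t} ((a′≤ , _) , v) → children-all t v (λ s≤ _ → inj₂ (≤-trans a′≤ s≤)))
      (All.zip (sorted⇒all itvOf ts sorted , vs))

allNodes-sound : ∀ G → All (Sound G) (allNodes G)
allNodes-sound G =
  nodesFrom-sound G (decomposition G) nothing (build-valid G (suc (size G)) (itv 0 (size G))) tt

-- Types of grandchildren

-- The vertices of `graphOn` are list positions, so membership has to record the index.
data At {X : Set} : List X → ℕ → X → Set where
  here  : ∀ {x xs} → At (x ∷ xs) 0 x
  there : ∀ {x y xs i} → At xs i x → At (y ∷ xs) (suc i) x

module _ {X : Set} where

  at-< : ∀ {xs : List X} {i x} → At xs i x → i < length xs
  at-< here       = s≤s z≤n
  at-< (there at) = s≤s (at-< at)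

  at-lookup : ∀ (xs : List X) {i} (i< : i < length xs) → At xs i (lookup xs (fromℕ< i<))
  at-lookup (x ∷ xs) {zero}  i< = here
  at-lookup (x ∷ xs) {suc i} i< = there (at-lookup xs (s≤s⁻¹ i<))

  at-all : ∀ {P : X → Set} {xs i x} → All P xs → At xs i x → P x
  at-all (px ∷ _)   here       = px
  at-all (_  ∷ pxs) (there at) = at-all pxs at

  at-++ˡ : ∀ {xs ys : List X} {i x} → At xs i x → At (xs ++ ys) i x
  at-++ˡ here       = here
  at-++ˡ (there at) = there (at-++ˡ at)

  at-++ʳ : ∀ (xs : List X) {ys i x} → At ys i x → At (xs ++ ys) (length xs + i) x
  at-++ʳ []       at = at
  at-++ʳ (_ ∷ xs) at = there (at-++ʳ xs at)

  at-++⁻ : ∀ (xs : List X) {ys i x} → At (xs ++ ys) i x →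
    At xs i x ⊎ ∃ λ j → i ≡ length xs + j × At ys j x
  at-++⁻ []       at = inj₂ (_ , refl , at)
  at-++⁻ (_ ∷ xs) here = inj₁ here
  at-++⁻ (_ ∷ xs) (there at) with at-++⁻ xs at
  ... | inj₁ at′             = inj₁ (there at′)
  ... | inj₂ (j , refl , at′) = inj₂ (j , refl , at′)

  at-∷ʳ-last : ∀ (xs : List X) {y i x} → suc i ≡ length (xs ++ [ y ]) → At (xs ++ [ y ]) i x → x ≡ y
  at-∷ʳ-last []       _  here       = refl
  at-∷ʳ-last []       () (there _)
  at-∷ʳ-last (_ ∷ []) () here
  at-∷ʳ-last (_ ∷ _ ∷ _) () here
  at-∷ʳ-last (_ ∷ xs) eq (there at) = at-∷ʳ-last xs (suc-injective eq) at

  dropWhile-suffix : ∀ (p : X → Bool) xs → ∃ λ pre → xs ≡ pre ++ dropWhileᵇ p xs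
  dropWhile-suffix p []       = [] , refl
  dropWhile-suffix p (x ∷ xs) with p x
  ... | false = [] , refl
  ... | true with dropWhile-suffix p xs
  ...   | pre , eq = x ∷ pre , cong (x ∷_) eq

  dropWhile-head : ∀ (p : X → Bool) xs {x} → At (dropWhileᵇ p xs) 0 x → p x ≡ false
  dropWhile-head p (y ∷ xs) at with p y in eq
  dropWhile-head p (y ∷ xs) at   | true  = dropWhile-head p xs at
  dropWhile-head p (y ∷ xs) here | false = eq

  filter-drop : ∀ (p : X → Bool) xs ys → All (λ x → p x ≡ false) xs → All (λ y → p y ≡ true) ys →
    filterᵇ p (xs ++ ys) ≡ ys
  filter-drop p []       []       _ _ = refl
  filter-drop p []       (y ∷ ys) _ (py ∷ pys) rewrite py = cong (y ∷_) (filter-drop p [] ys [] pys)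
  filter-drop p (x ∷ xs) ys (px ∷ pxs) pys rewrite px = filter-drop p xs ys pxs pys

own : Side → Label
own left  = lL
own right = lR

isOwn primed : Side → Label → Bool
isOwn left   = isTypeL
isOwn right  = isTypeR
primed left  = isL'
primed right = isR'

isOwn⇒≡ : ∀ z l → isOwn z l ≡ true → l ≡ own z
isOwn⇒≡ left  lL _ = refl
isOwn⇒≡ right lR _ = refl

-- Trimming leaves a contiguous block, to which `Sorted`, `Seeing` and `Filled` pass. The conditions
-- on its two ends become `marked-first` and `marked-last`.
trim-spec : ∀ z xs → ∃₂ λ pre post → xs ≡ pre ++ (trim (isOwn z) xs ++ post)
  × (∀ {a} → At (trim (isOwn z) xs) 0 a → typ a ≡ own z)
  × (∀ {t a} → suc t ≡ length (trim (isOwn z) xs) → At (trim (isOwn z) xs) t a → typ a ≡ own z)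
trim-spec z xs with dropWhile-suffix (λ a → not (isOwn z (typ a))) xs
... | pre , eq with dropWhile-suffix (λ a → not (isOwn z (typ a)))
                      (reverse (dropWhileᵇ (λ a → not (isOwn z (typ a))) xs))
... | post , eq′ = pre , reverse post , trans eq (cong (pre ++_) split) , first , last zs zs-head
  where
  p : Item → Bool
  p a = not (isOwn z (typ a))

  ys zs : List Item
  ys = dropWhileᵇ p xs
  zs = dropWhileᵇ p (reverse ys)

  split : ys ≡ reverse zs ++ reverse post
  split = trans (sym (reverse-involutive ys)) (trans (cong reverse eq′) (reverse-++ post zs))

  ¬p⇒own : ∀ {a} → p a ≡ false → typ a ≡ own z
  ¬p⇒own {a} h with isOwn z (typ a) in e
  ... | true = isOwn⇒≡ z (typ a) e

  first : ∀ {a} → At (reverse zs) 0 a → typ a ≡ own z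
  first {a} at = ¬p⇒own {a} (dropWhile-head p xs (subst (λ l → At l 0 a) (sym split) (at-++ˡ at)))

  zs-head : ∀ {a} → At zs 0 a → typ a ≡ own z
  zs-head {a} at = ¬p⇒own {a} (dropWhile-head p (reverse ys) at)

  last : ∀ ws → (∀ {a} → At ws 0 a → typ a ≡ own z) →
    ∀ {t a} → suc t ≡ length (reverse ws) → At (reverse ws) t a → typ a ≡ own z
  last (w ∷ ws) head len at rewrite unfold-reverse w ws with at-∷ʳ-last (reverse ws) len at
  ... | refl = head here

Between : Side → List Item → ℕ → ℕ → Set
Between z xs i j = ∃₂ λ t c → i ≤ t × t ≤ j × At xs t c × typ c ≡ own z

-- Positional form of the claim that an edge spans a vertex of type `z` whenever its right endpoint
-- has type `z` or O_z. Of the edge itself only the fact that it joins different classes is used.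
Filled : Side → List Item → Set
Filled z xs = ∀ {i j a b} → i < j → At xs i a → At xs j b → grp a ≢ grp b →
  primed z (typ b) ≡ true → Between z xs i j

filled-++⁻ʳ : ∀ z xs {ys} → Filled z (xs ++ ys) → Filled z ys
filled-++⁻ʳ z xs fill {i} {j} i<j ati atj g≢ pr
  with fill (+-monoʳ-< (length xs) i<j) (at-++ʳ xs ati) (at-++ʳ xs atj) g≢ pr
... | t , c , ≤t , t≤ , at , own≡ with at-++⁻ xs at
...   | inj₁ at′ = contradiction (at-< at′) (≤⇒≯ (≤-trans (m≤m+n _ i) ≤t))
...   | inj₂ (t′ , refl , at′) =
  t′ , c , +-cancelˡ-≤ (length xs) i t′ ≤t , +-cancelˡ-≤ (length xs) t′ j t≤ , at′ , own≡

filled-++⁻ˡ : ∀ z xs {ys} → Filled z (xs ++ ys) → Filled z xs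
filled-++⁻ˡ z xs fill i<j ati atj g≢ pr with fill i<j (at-++ˡ ati) (at-++ˡ atj) g≢ pr
... | t , c , ≤t , t≤ , at , own≡ with at-++⁻ xs at
...   | inj₁ at′ = t , c , ≤t , t≤ , at′ , own≡
...   | inj₂ (t′ , refl , _) = contradiction (≤-<-trans t≤ (at-< atj)) (≤⇒≯ (m≤m+n _ t′))

data Raw : Label → Set where
  rawR : Raw lR
  rawL : Raw lL
  rawO : Raw lO

adjust-own : ∀ z prev → adjust prev (own z) ≡ own z
adjust-own left  l∅  = refl
adjust-own left  lR  = refl
adjust-own left  lL  = refl
adjust-own left  lO  = refl
adjust-own left  lOL = refl
adjust-own left  lOR = refl
adjust-own right l∅  = refl
adjust-own right lR  = refl
adjust-own right lL  = refl
adjust-own right lO  = refl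
adjust-own right lOL = refl
adjust-own right lOR = refl

-- Adjustment changes nothing but O, and that only into O_L or O_R. So an adjusted label R or L
-- still reports a cousin on its side.
adjust-own⁻ : ∀ z prev {l} → Raw l → adjust prev l ≡ own z → l ≡ own z
adjust-own⁻ z     prev rawR eq = trans (sym (adjust-own right prev)) eq
adjust-own⁻ z     prev rawL eq = trans (sym (adjust-own left prev)) eq
adjust-own⁻ left  l∅ rawO ()
adjust-own⁻ left  lR rawO ()
adjust-own⁻ left  lL rawO ()
adjust-own⁻ left  lO rawO ()
adjust-own⁻ left  lOL rawO ()
adjust-own⁻ left  lOR rawO ()
adjust-own⁻ right l∅ rawO ()
adjust-own⁻ right lR rawO ()
adjust-own⁻ right lL rawO ()
adjust-own⁻ right lO rawO ()
adjust-own⁻ right lOL rawO ()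
adjust-own⁻ right lOR rawO ()

raw-primed : ∀ z {l} → Raw l → primed z l ≡ true → l ≡ own z
raw-primed left  rawL _ = refl
raw-primed right rawR _ = refl

adjust-primed : ∀ z prev {l} → Raw l → primed z (adjust prev l) ≡ true → prev ≡ own z ⊎ l ≡ own z
adjust-primed z     prev rawR h rewrite adjust-own right prev = inj₂ (raw-primed z rawR h)
adjust-primed z     prev rawL h rewrite adjust-own left prev  = inj₂ (raw-primed z rawL h)
adjust-primed left  lL   rawO h = inj₁ refl
adjust-primed right lR   rawO h = inj₁ refl
adjust-primed left  lR   rawO ()
adjust-primed left  l∅   rawO ()
adjust-primed left  lO   rawO ()
adjust-primed left  lOL  rawO ()
adjust-primed left  lOR  rawO ()
adjust-primed right lL   rawO ()
adjust-primed right l∅   rawO ()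
adjust-primed right lO   rawO ()
adjust-primed right lOL  rawO ()
adjust-primed right lOR  rawO ()

block : ℕ → Label → Tree → List Item
block k l c = map (λ gc → item (itvOf gc) k l) (children c)

block-all : ∀ k l c → All (λ a → grp a ≡ k × typ a ≡ l) (block k l c)
block-all k l c = All.map⁺ (All.universal (λ _ → refl , refl) (children c))

block-head : ∀ k l c → children c ≢ [] → ∃ λ a → At (block k l c) 0 a × typ a ≡ l
block-head k l (node _ [])      ne = contradiction refl ne
block-head k l (node _ (_ ∷ _)) _  = _ , here , refl

at-parent : ∀ k cs ls {j b} → At (itemsFrom k cs ls) j b → ∃ λ c → c ∈ cs × children c ≢ []
at-parent k (c ∷ cs) (l ∷ ls) at with at-++⁻ (block k l c) at
... | inj₂ (_ , _ , at′) with at-parent (suc k) cs ls at′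
...   | c′ , c′∈ , ne = c′ , there c′∈ , ne
at-parent k (node I (_ ∷ _) ∷ cs) (l ∷ ls) at | inj₁ _ = _ , here refl , λ ()

-- A class of type O_z directly follows one of type `z`. That predecessor is either in `cs`, which
-- gives the second alternative, or the child just before `cs`, whose original label is `prev`.
own-before : ∀ z k prev cs raws → Uniform cs → All Raw raws → ∀ {j b} →
  At (itemsFrom k cs (adjustFrom prev raws)) j b → primed z (typ b) ≡ true →
  prev ≡ own z ⊎ Between z (itemsFrom k cs (adjustFrom prev raws)) 0 j
own-before z k prev (c ∷ cs) (r ∷ raws) uni (raw ∷ rs) {j} {b} at pr
  with at-++⁻ (block k (adjust prev r) c) at
... | inj₁ at′ with at-all (block-all k _ c) at′
...   | _ , refl with adjust-primed z prev raw pr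
...     | inj₁ p≡ = inj₁ p≡
...     | inj₂ refl = inj₂ (j , b , z≤n , ≤-refl , at , adjust-own z prev)
own-before z k prev (c ∷ cs) (r ∷ raws) uni (raw ∷ rs) {j} {b} at pr | inj₂ (j′ , refl , at′)
  with own-before z (suc k) r cs raws (λ c∈ c′∈ → uni (there c∈) (there c′∈)) rs at′ pr
... | inj₂ (t , d , _ , t≤ , att , own≡) =
  inj₂ (_ , d , z≤n , +-monoʳ-≤ _ t≤ , at-++ʳ (block k _ c) att , own≡)
-- Here `c` itself has type `z`, but it witnesses the claim only through a child. It has one by
-- uniformity, since the later sibling containing position `j′` has.
... | inj₁ refl with at-parent (suc k) cs _ at′
...   | c′ , c′∈ , ne with block-head k (adjust prev (own z)) c (uni (there c′∈) (here refl) ne)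
...     | a , ata , typ≡ = inj₂ (0 , a , z≤n , z≤n , at-++ˡ ata , trans typ≡ (adjust-own z prev))

-- If `i` lies in the first block and `j` in a later one, `own-before` yields a vertex of type `z`
-- in the later blocks up to `j`, or shows that the block of `i` has type `z`; then `i` itself is
-- the witness.
adjusted-filled : ∀ z k prev cs raws → Uniform cs → All Raw raws →
  Filled z (itemsFrom k cs (adjustFrom prev raws))
adjusted-filled z k prev (c ∷ cs) (r ∷ raws) uni (raw ∷ rs) {i} {j} {a} {b} i<j ati atj g≢ pr
  with at-++⁻ (block k (adjust prev r) c) ati | at-++⁻ (block k (adjust prev r) c) atj
... | inj₁ ati′ | inj₁ atj′ =
  contradiction (trans (proj₁ (at-all (block-all k _ c) ati′))
                       (sym (proj₁ (at-all (block-all k _ c) atj′)))) g≢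
... | inj₂ (i′ , refl , _) | inj₁ atj′ =
  contradiction (<-trans i<j (at-< atj′)) (≤⇒≯ (m≤m+n _ i′))
... | inj₁ ati′ | inj₂ (j′ , refl , atj′)
  with own-before z (suc k) r cs raws (λ c∈ c′∈ → uni (there c∈) (there c′∈)) rs atj′ pr
...   | inj₁ refl =
  i , a , ≤-refl , <⇒≤ i<j , ati , trans (proj₂ (at-all (block-all k _ c) ati′)) (adjust-own z prev)
...   | inj₂ (t , d , _ , t≤ , att , own≡) =
  _ , d , ≤-trans (<⇒≤ (at-< ati′)) (m≤m+n _ t) , +-monoʳ-≤ _ t≤ , at-++ʳ (block k _ c) att , own≡
adjusted-filled z k prev (c ∷ cs) (r ∷ raws) uni (raw ∷ rs) {i} {j} {a} {b} i<j ati atj g≢ pr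
  | inj₂ (i′ , refl , ati′) | inj₂ (j′ , refl , atj′)
  with adjusted-filled z (suc k) r cs raws (λ c∈ c′∈ → uni (there c∈) (there c′∈)) rs
         (+-cancelˡ-< (length (block k (adjust prev r) c)) i′ j′ i<j) ati′ atj′ g≢ pr
... | t , d , ≤t , t≤ , att , own≡ =
  _ , d , +-monoʳ-≤ _ ≤t , +-monoʳ-≤ _ t≤ , at-++ʳ (block k _ c) att , own≡

items-all : ∀ {P : Tree → Label → Set} {Q : Item → Set} →
  (∀ {c l k} → P c l → All Q (block k l c)) →
  ∀ k {cs ls} → Pointwise P cs ls → All Q (itemsFrom k cs ls)
items-all f k []       = []
items-all f k (p ∷ ps) = All.++⁺ (f p) (items-all f (suc k) ps)

items-labels : ∀ {P : Label → Set} k cs {ls} → All P ls → All (P ∘ typ) (itemsFrom k cs ls)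
items-labels k []       _        = []
items-labels k (c ∷ cs) []       = []
items-labels k (c ∷ cs) (p ∷ ps) =
  All.++⁺ (All.map⁺ (All.universal (λ _ → p) (children c))) (items-labels (suc k) cs ps)

-- Without labels O_z the right endpoint is its own witness.
plain-filled : ∀ z k cs {ls} → All (λ l → primed z l ≡ true → l ≡ own z) ls →
  Filled z (itemsFrom k cs ls)
plain-filled z k cs ps {j = j} {b = b} i<j _ atj _ pr =
  j , b , <⇒≤ i<j , ≤-refl , atj , at-all (items-labels k cs ps) atj pr

rawLabel-raw : ∀ G c pool → Raw (rawLabel G c pool)
rawLabel-raw G c pool
  with any (λ c' → before (itvOf c) (itvOf c') ∧ edgeBetween G (itvOf c) (itvOf c')) pool
... | true = rawR
... | false with any (λ c' → before (itvOf c') (itvOf c) ∧ edgeBetween G (itvOf c) (itvOf c')) pool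
...   | true  = rawL
...   | false = rawO

modified-filled : ∀ z k cs raws → Uniform cs → All Raw raws →
  Filled z (itemsFrom k cs (modifyLabels raws))
modified-filled z k cs []       uni rs = plain-filled z k cs []
modified-filled z k cs (r ∷ raws) uni rs with 3 ≤ᵇ length (r ∷ raws)
-- Starting from `l∅` leaves the first label unadjusted, as `modifyLabels` does.
... | true  = adjusted-filled z k l∅ cs (r ∷ raws) uni rs
... | false = plain-filled z k cs (All.map (raw-primed z) rs)

childLabels-filled : ∀ z G x pool → Valid G x → Filled z (itemsFrom 0 (children x) (childLabels G x pool))
childLabels-filled z G x nothing _ =
  plain-filled z 0 (children x) (All.replicate⁺ (length (children x)) (λ h → contradiction h (l∅-unprimed z)))
  where
  l∅-unprimed : ∀ z → primed z l∅ ≢ true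
  l∅-unprimed left  ()
  l∅-unprimed right ()
childLabels-filled z G (node I cs) (just pool) (valid _ _ uni _) =
  modified-filled z 0 cs _ uni (All.map⁺ (All.universal (λ c → rawLabel-raw G c pool) cs))

-- Refined quotients

AllSee : OrderedGraph → Side → Interval → Interval → Set
AllSee G z I J = ∀ u → Inside J u → Sees G z (start I) (stop I) u

own-raw⇒neighbour : ∀ z G c pool → rawLabel G c pool ≡ own z → ∃ λ c′ → c′ ∈ pool ×
  edgeBetween G (itvOf c) (itvOf c′) ≡ true ×
  (z ≡ left × stop (itvOf c′) ≤ start (itvOf c) ⊎ z ≡ right × stop (itvOf c) ≤ start (itvOf c′))
own-raw⇒neighbour z G c pool h
  with any (λ c' → before (itvOf c) (itvOf c') ∧ edgeBetween G (itvOf c) (itvOf c')) pool in eqR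
own-raw⇒neighbour right G c pool h | true with any-true _ pool eqR
... | c′ , c′∈ , e = c′ , c′∈ , ∧-conicalʳ (before (itvOf c) (itvOf c′)) _ e ,
  inj₂ (refl , ≤ᵇ⇒≤ (stop (itvOf c)) (start (itvOf c′))
                 (subst T (sym (∧-conicalˡ (before (itvOf c) (itvOf c′)) _ e)) tt))
own-raw⇒neighbour z G c pool h | false
  with any (λ c' → before (itvOf c') (itvOf c) ∧ edgeBetween G (itvOf c) (itvOf c')) pool in eqL
own-raw⇒neighbour left G c pool h | false | true with any-true _ pool eqL
... | c′ , c′∈ , e = c′ , c′∈ , ∧-conicalʳ (before (itvOf c′) (itvOf c)) _ e ,
  inj₁ (refl , ≤ᵇ⇒≤ (stop (itvOf c′)) (start (itvOf c))
                 (subst T (sym (∧-conicalˡ (before (itvOf c′) (itvOf c)) _ e)) tt))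
own-raw⇒neighbour left  G c pool () | false | false
own-raw⇒neighbour right G c pool () | false | false

-- All vertices of L(c) have the same neighbours outside L(x), so one edge leaving
-- L(x) towards side z gives such an edge at every vertex of L(c).
own-raw⇒allSee : ∀ z G I c pool → start I ≤ start (itvOf c) → 1 ≤ len (itvOf c) →
  stop (itvOf c) ≤ stop I → Homogeneous G I (itvOf c) → All (Apart I ∘ itvOf) pool →
  rawLabel G c pool ≡ own z → AllSee G z I (itvOf c)
own-raw⇒allSee z G I c pool s≤ 1≤l ≤e hom apart h u u∈ with own-raw⇒neighbour z G c pool h
... | c′ , c′∈ , eb , side with edgeBetween⁻ G (itvOf c) (itvOf c′) eb
...   | v , w , v∈ , (s≤w , w<e) , e = sees side (All.lookup apart c′∈)
  where
  J J′ : Interval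
  J = itvOf c
  J′ = itvOf c′

  s<e : start J < stop J
  s<e = subst (_≤ stop J) (+-comm (start J) 1) (+-monoʳ-≤ (start J) 1≤l)

  edge : Outside I w → edgeℕ G w u ≡ true
  edge out = trans (hom u v u∈ v∈ w out) (trans (edgeℕ-sym G w v) e)

  sees : z ≡ left × stop J′ ≤ start J ⊎ z ≡ right × stop J ≤ start J′ → Apart I J′ →
    Sees G z (start I) (stop I) u
  sees (inj₁ (refl , _)) (inj₁ e≤s) =
    w , w<s , <-≤-trans w<s (≤-trans s≤ (proj₁ u∈)) , edge (inj₁ w<s)
    where w<s = <-≤-trans w<e e≤s
  -- A cousin before `J` cannot lie after `I`, because `J` is a nonempty subinterval of `I`.
  sees (inj₁ (refl , J′≤J)) (inj₂ e≤s) =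
    contradiction (≤-trans (m≤m+n (start J′) (len J′)) J′≤J) (<⇒≱ (<-≤-trans s<e (≤-trans ≤e e≤s)))
  sees (inj₂ (refl , J≤J′)) (inj₁ e≤s) =
    contradiction (≤-trans J≤J′ (≤-trans (m≤m+n (start J′) (len J′)) (≤-trans e≤s s≤))) (<⇒≱ s<e)
  sees (inj₂ (refl , _)) (inj₂ e≤s) =
    w , e≤w , <-≤-trans (proj₂ u∈) (≤-trans ≤e e≤w) , trans (edgeℕ-sym G u w) (edge (inj₂ e≤w))
    where e≤w = ≤-trans e≤s s≤w

Faithful : OrderedGraph → Side → Interval → Tree → Label → Set
Faithful G z I c l = Valid G c × (l ≡ own z → AllSee G z I (itvOf c))

faithful-replicate : ∀ z G I cs → All (Valid G) cs →
  Pointwise (Faithful G z I) cs (replicate (length cs) l∅)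
faithful-replicate z G I []       _        = []
faithful-replicate z G I (c ∷ cs) (v ∷ vs) = (v , λ h → contradiction h (l∅≢own z)) ∷ faithful-replicate z G I cs vs
  where
  l∅≢own : ∀ z → l∅ ≢ own z
  l∅≢own left  ()
  l∅≢own right ()

module _ (G : OrderedGraph) (z : Side) (I : Interval) (raw : Tree → Label)
  (isRaw : ∀ c → Raw (raw c)) where

  faithful-map : ∀ {cs} → All (λ c → Faithful G z I c (raw c)) cs →
    Pointwise (Faithful G z I) cs (map raw cs)
  faithful-map []       = []
  faithful-map (p ∷ ps) = p ∷ faithful-map ps

  faithful-adjust : ∀ prev {cs} → All (λ c → Faithful G z I c (raw c)) cs →
    Pointwise (Faithful G z I) cs (adjustFrom prev (map raw cs))
  faithful-adjust prev [] = []
  faithful-adjust prev {c ∷ _} ((v , see) ∷ ps) =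
    (v , see ∘ adjust-own⁻ z prev (isRaw c)) ∷ faithful-adjust (raw c) ps

  faithful-modify : ∀ {cs} → All (λ c → Faithful G z I c (raw c)) cs →
    Pointwise (Faithful G z I) cs (modifyLabels (map raw cs))
  faithful-modify [] = []
  faithful-modify {c ∷ cs} ps with 3 ≤ᵇ length (map raw (c ∷ cs))
  ... | true  = faithful-adjust l∅ ps
  ... | false = faithful-map ps

childLabels-faithful : ∀ z G x pool → Valid G x → PoolApart (itvOf x) pool →
  Pointwise (Faithful G z (itvOf x)) (children x) (childLabels G x pool)
childLabels-faithful z G (node I cs) nothing     (valid _ _ _ vs) _ = faithful-replicate z G I cs vs
childLabels-faithful z G (node I cs) (just pool) (valid sorted hom _ vs) apart =
  faithful-modify G z I (λ c → rawLabel G c pool) (λ c → rawLabel-raw G c pool)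
    (All.map (λ {c} ((s≤ , 1≤l , ≤e) , h , v) → v , own-raw⇒allSee z G I c pool s≤ 1≤l ≤e h apart)
      (All.zip (sorted⇒all itvOf cs sorted , All.zip (hom , vs))))

Seeing : OrderedGraph → Side → Interval → Item → Set
Seeing G z I a = typ a ≡ own z → AllSee G z I (iv a)

items-seeing : ∀ z G I k {cs ls} → Pointwise (Faithful G z I) cs ls →
  All (Seeing G z I) (itemsFrom k cs ls)
items-seeing z G I = items-all λ {c} (v , see) →
  All.map⁺ (children-all c v λ s≤ ≤e h u (s≤u , u<e) → see h u (≤-trans s≤ s≤u , <-≤-trans u<e ≤e))

items-sorted : ∀ G k cs ls {a b} → Sorted itvOf a b cs → All (Valid G) cs →
  Sorted iv a b (itemsFrom k cs ls)
items-sorted G k []       ls       s _ = s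
items-sorted G k (c ∷ cs) []       s _ = sorted-≤ itvOf (c ∷ cs) s
items-sorted G k (node I gs ∷ cs) (l ∷ ls) (a≤s , _ , s) (valid sg _ _ _ ∷ vs) =
  sorted-++⁺ iv (block k l (node I gs))
    (sorted-map itvOf _ (λ _ → refl) gs (sorted-weakenˡ itvOf gs a≤s sg))
    (items-sorted G (suc k) cs ls s vs)

items-grp : ∀ k cs ls → All (λ a → k ≤ grp a) (itemsFrom k cs ls)
items-grp k []       ls       = []
items-grp k (c ∷ cs) []       = []
items-grp k (c ∷ cs) (l ∷ ls) =
  All.++⁺ (All.map (λ (g , _) → ≤-reflexive (sym g)) (block-all k l c))
          (All.map <⇒≤ (items-grp (suc k) cs ls))

-- The deleted grandchildren are those of group 0, which form an initial block.
remaining-suffix : ∀ x labs → ∃ λ pre →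
  itemsFrom 0 (children x) labs ≡ pre ++ remainingItems (x , labs)
remaining-suffix x [] = [] , refl
remaining-suffix x (l∅ ∷ ls) = [] , refl
remaining-suffix x (lR ∷ ls) = [] , refl
remaining-suffix x (lL ∷ ls) = [] , refl
remaining-suffix x (lOL ∷ ls) = [] , refl
remaining-suffix x (lOR ∷ ls) = [] , refl
remaining-suffix (node I []) (lO ∷ ls) = [] , refl
remaining-suffix (node I (c ∷ cs)) (lO ∷ ls) =
  block 0 lO c , cong (block 0 lO c ++_) (sym (filter-drop _ (block 0 lO c) (itemsFrom 1 cs ls)
    (All.map (λ { (refl , _) → refl }) (block-all 0 lO c))
    (All.map (λ { {item _ (suc _) _} _ → refl }) (items-grp 1 cs ls))))

-- This is the map `lift`. Positions past the end go to `hi`, which keeps it total and monotone and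
-- closes the last interval.
position : ℕ → List Item → ℕ → ℕ
position hi []       i       = hi
position hi (x ∷ xs) zero    = start (iv x)
position hi (x ∷ xs) (suc i) = position hi xs i

module _ {hi : ℕ} where

  position-≥ : ∀ xs {lo} → Sorted iv lo hi xs → ∀ i → lo ≤ position hi xs i
  position-≥ []       s         i       = s
  position-≥ (x ∷ xs) (≤s , _)  zero    = ≤s
  position-≥ (x ∷ xs) (≤s , _ , s) (suc i) = ≤-trans ≤s (≤-trans (m≤m+n _ _) (position-≥ xs s i))

  position-≤ : ∀ xs {lo} → Sorted iv lo hi xs → ∀ i → position hi xs i ≤ hi
  position-≤ []       s i = ≤-refl
  position-≤ (x ∷ xs) (_ , _ , s) zero    = ≤-trans (m≤m+n _ _) (sorted-≤ iv xs s)
  position-≤ (x ∷ xs) (_ , _ , s) (suc i) = position-≤ xs s i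

  position-mono : ∀ xs {lo} → Sorted iv lo hi xs → ∀ {i j} → i ≤ j → position hi xs i ≤ position hi xs j
  position-mono []       s i≤j = ≤-refl
  position-mono (x ∷ xs) s {j = zero} z≤n = ≤-refl
  position-mono (x ∷ xs) (_ , _ , s) {j = suc j} z≤n = ≤-trans (m≤m+n _ _) (position-≥ xs s j)
  position-mono (x ∷ xs) (_ , _ , s) (s≤s i≤j) = position-mono xs s i≤j

  position-part : ∀ xs {lo} → Sorted iv lo hi xs → ∀ {i a} → At xs i a →
    ∀ {u} → Inside (iv a) u → Part (position hi xs) i u
  position-part (x ∷ xs) (_ , _ , s) here (s≤u , u<) = s≤u , <-≤-trans u< (position-≥ xs s 0)
  position-part (x ∷ xs) (_ , _ , s) (there at) u∈ = position-part xs s at u∈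

graphOn-edge : ∀ xs f {u v} → E (graphOn xs f) u v →
  ∃₂ λ a b → At xs u a × At xs v b × f a b ≡ true
graphOn-edge xs f {u} {v} e with E-adj (graphOn xs f) u v e
... | p , q , h = _ , _ , at-lookup xs p , at-lookup xs q , h

refines : ∀ z G I p xs → Sorted iv (start I) (stop I) xs → All (Seeing G z I) xs → Filled z xs →
  (∀ {a} → At xs 0 a → typ a ≡ own z) →
  (∀ {t a} → suc t ≡ length xs → At xs t a → typ a ≡ own z) →
  Refines z (graphOn xs (classEdge G p (primed z))) G
refines z G I p xs sorted see fill first last = record
  { lift = position (stop I) xs
  ; lo = start I
  ; hi = stop I
  ; mono = position-mono xs sorted
  ; lo≤ = position-≥ xs sorted
  ; ≤hi = position-≤ xs sorted
  ; edge = edge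
  ; marked-between = between
  ; marked-first = λ 0< → marked (at-lookup xs 0<) (first (at-lookup xs 0<))
  ; marked-last = λ {t} eq → let at = at-lookup xs (≤-reflexive eq) in marked at (last eq at)
  }
  where
  H : OrderedGraph
  H = graphOn xs (classEdge G p (primed z))

  marked : ∀ {t c} → At xs t c → typ c ≡ own z →
    ∃ λ u → Part (position (stop I) xs) t u × Sees G z (start I) (stop I) u
  marked {t} {c} at own≡ =
    start (iv c) , position-part xs sorted at s∈ , at-all see at own≡ _ s∈
    where
    s∈ : Inside (iv c) (start (iv c))
    s∈ = ≤-refl , subst (_≤ stop (iv c)) (+-comm (start (iv c)) 1)
      (+-monoʳ-≤ (start (iv c)) (proj₁ (proj₂ (at-all (sorted⇒all iv xs sorted) at))))

  edge : ∀ {u v} → E H u v → ∃₂ λ u′ v′ →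
    Part (position (stop I) xs) u u′ × Part (position (stop I) xs) v v′ × E G u′ v′
  edge {u} {v} e@(u<v , _) with graphOn-edge xs (classEdge G p (primed z)) e
  ... | a , b , ata , atb , ce
    with edgeBetween⁻ G (iv a) (iv b)
           (∧-conicalʳ (not (grp a ≡ᵇ grp b)) _ (∧-conicalˡ (qEdge G a b) _ ce))
  ...   | u′ , v′ , u∈ , v∈ , e′ with position-part xs sorted ata {u′} u∈ | position-part xs sorted atb {v′} v∈
  ...     | pu | pv =
    u′ , v′ , pu , pv ,
    <-≤-trans (proj₂ pu) (≤-trans (position-mono xs sorted u<v) (proj₁ pv)) , e′

  between : ∀ {u v} → E H u v → ∃ λ t → u ≤ t × t ≤ v ×
    ∃ λ w → Part (position (stop I) xs) t w × Sees G z (start I) (stop I) w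
  between {u} {v} e@(u<v , _) with graphOn-edge xs (classEdge G p (primed z)) e
  ... | a , b , ata , atb , ce
    -- The last conjunct of `classEdge` puts the type of the right endpoint into the class of `z`;
    -- the class `p` of the left endpoint is arbitrary.
    with fill u<v ata atb g≢ (∧-conicalʳ (p (typ a)) _ (∧-conicalʳ (qEdge G a b) _ ce))
    where
    g≢ : grp a ≢ grp b
    g≢ g≡ with ∧-conicalˡ (not (grp a ≡ᵇ grp b)) _ (∧-conicalˡ (qEdge G a b) _ ce)
    ... | h = subst (T ∘ not) (Equivalence.to T-≡ (≡⇒≡ᵇ (grp a) (grp b) g≡)) (subst T (sym h) tt)
  ...   | t , c , u≤t , t≤v , at , own≡ = t , u≤t , t≤v , marked at own≡

class-refines : ∀ z G p x labs → Sound G (x , labs) →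
  Refines z (graphOn (trim (isOwn z) (remainingItems (x , labs))) (classEdge G p (primed z))) G
class-refines z G p x@(node I cs) labs (v@(valid sorted _ _ vs) , pool , refl , apart)
  with remaining-suffix x labs | trim-spec z (remainingItems (x , labs))
... | pre , eq | pre′ , post , eq′ , first , last =
  refines z G I p ys
    (sorted-++⁻ˡ iv ys (sorted-++⁻ʳ iv pre′ (subst (Sorted iv (start I) (stop I)) eq′
      (sorted-++⁻ʳ iv pre (subst (Sorted iv (start I) (stop I)) eq (items-sorted G 0 cs labs sorted vs))))))
    (All.++⁻ˡ ys (All.++⁻ʳ pre′ (subst (All (Seeing G z I)) eq′
      (All.++⁻ʳ pre (subst (All (Seeing G z I)) eq
        (items-seeing z G I 0 (childLabels-faithful z G x pool v apart)))))))
    (filled-++⁻ˡ z ys (filled-++⁻ʳ z pre′ (subst (λ l → Filled z l) eq′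
      (filled-++⁻ʳ z pre (subst (λ l → Filled z l) eq (childLabels-filled z G x pool v))))))
    first last
  where
  ys : List Item
  ys = trim (isOwn z) (remainingItems (x , labs))

-- In each of the four graphs the trimming type is that of the right endpoints of the edges, and
-- this determines the side.
fourRefined-refines : ∀ G xl {H} → Sound G xl → H ∈ fourRefined G xl → ∃ λ z → Refines z H G
fourRefined-refines G (x , labs) s (here refl) = right , class-refines right G isR' x labs s
fourRefined-refines G (x , labs) s (there (here refl)) = left , class-refines left G isR' x labs s
fourRefined-refines G (x , labs) s (there (there (here refl))) = right , class-refines right G isL' x labs s
fourRefined-refines G (x , labs) s (there (there (there (here refl)))) = left , class-refines left G isL' x labs s

-- Delayed rank and repeated refinement

rank-refines : ∀ {G d} → DelayedRank G (suc (suc d)) →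
  ∃₂ λ H z → Refines z H G × DelayedRank H (suc d)
rank-refines {G} (rank-suc _ _ (H , (xl , xl∈ , inj₂ (_ , H∈)) , rk))
  with fourRefined-refines G xl (All.lookup (allNodes-sound G) xl∈) H∈
... | z , R = H , z , R , rk
-- A refined quotient of positive rank is not monotone bipartite, so it cannot be an unsplit
-- quotient graph.
rank-refines (rank-suc _ _ (_ , (_ , _ , inj₁ (mb , refl)) , rank-suc ¬mb _ _)) = contradiction mb ¬mb

-- Each increase of `r` is paid for by three refinements, each lowering the rank by one. The base
-- case has positive rank, hence an edge, and the whole vertex set is a fat K_1.
rank⇒fatMinor : ∀ r {G d} → DelayedRank G d → r * 3 < d → ∃ λ cut → FatMinor G (suc r) cut
rank⇒fatMinor zero {G} (rank-suc ¬mb _ _) _ with ¬MB⇒edge G ¬mb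
... | u , v , e@(u<v , h) = cut , fat
  where
  cut : ℕ → ℕ
  cut zero    = 0
  cut (suc _) = size G

  fat : FatMinor G 1 cut
  fat .FatMinor.inner zero _ =
    u , v , (z≤n , proj₁ (edgeℕ-bound G u v h)) , (z≤n , proj₂ (edgeℕ-bound G u v h)) , e
  fat .FatMinor.inner (suc _) (s≤s ())
  fat .FatMinor.cross _ (suc _) _ (s≤s ())
rank⇒fatMinor (suc r) {d = suc (suc (suc (suc d)))} rk (s≤s (s≤s (s≤s r<)))
  with rank-refines rk
... | _ , z₁ , R₁ , rk₁ with rank-refines rk₁
... | _ , z₂ , R₂ , rk₂ with rank-refines rk₂
... | _ , z₃ , R₃ , rk₃ = threeSteps z₁ z₂ z₃ R₃ R₂ R₁ (proj₂ (rank⇒fatMinor r rk₃ r<))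
rank⇒fatMinor (suc r) {d = suc (suc (suc zero))} rk (s≤s (s≤s (s≤s ())))

theorem21 : ∀ (r : ℕ) → 1 ≤ r → ∀ (G : OrderedGraph) (d : ℕ) →
    DelayedRank G d → 3 * r ∸ 2 ≤ d → HasKrIntervalMinor G r
theorem21 (suc r) _ G d rk bound =
  fatMinor⇒intervalMinor G r _ (proj₂ (rank⇒fatMinor r rk (subst (_≤ d) arith bound)))
  where
  arith : 3 * suc r ∸ 2 ≡ suc (r * 3)
  -- After commuting, `suc r * 3` computes to `3 + r * 3`, and subtracting 2 leaves the strict bound
  -- in successor form.
  arith = cong (_∸ 2) (*-comm 3 (suc r))
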